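{- Let $G_0$, $G$, $H$ be graphs such that $G$ is a region intersection graph over $G_0$, and let $\dot H$ be the graph obtained from $H$ by subdividing every edge into a path of length two. If $\dot H$ is a strict minor of $G$, then $H$ is a minor of $G_0$.
   Context: All graphs are finite, undirected and simple; $V_G,E_G$ denote the vertex and edge sets, and $E_G(A,B)$ the set of edges with one endpoint in $A$ and the other in $B$. $G$ is a region intersection graph (rig) over $G_0$ if there are nonempty subsets $\{R_u\subseteq V_{G_0}:u\in V_G\}$, each inducing a connected subgraph of $G_0$, such that for distinct $u,v\in V_G$: $\{u,v\}\in E_G\iff R_u\cap R_v\neq\emptyset$. $H$ is a minor of $G$ if there are pairwise disjoint nonempty connected subsets $\{A_u\subseteq V_G:u\in V_H\}$ such that $\{u,v\}\in E_H\Rightarrow E_G(A_u,A_v)\neq\emptyset$. $H$ is a strict minor of $G$ if such sets can be chosen so that for distinct $u,v\in V_H$ the stronger condition $\{u,v\}\in E_H\iff E_G(A_u,A_v)\ne\emptyset$ holds (equivalently, $H$ can be obtained from $G$ by edge contractions and vertex deletions only). -}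

module Defs where

open import Level using (0ℓ)
open import Data.Empty using (⊥)
open import Data.Fin using (Fin; splitAt)
open import Data.Fin.Properties using (_≟_; _<?_)
open import Data.Fin.Subset using (Subset; _∈_; _∩_; Nonempty; Empty)
open import Data.List using (List; length; lookup; filter; cartesianProduct; allFin)
open import Data.Nat using (ℕ; _+_)
open import Data.Product using (Σ; ∃₂; _×_; _,_)
open import Data.Sum using (_⊎_; inj₁; inj₂)
open import Function.Base using (_on_)
open import Function.Bundles using (_⇔_)
open import Relation.Binary.Construct.Closure.ReflexiveTransitive using (Star)
open import Relation.Binary.Core using (Rel)
open import Relation.Binary.Definitions using (Decidable; Symmetric)
open import Relation.Binary.PropositionalEquality using (_≡_; _≢_)
open import Relation.Nullary using (¬_; Dec; no)
open import Relation.Nullary.Decidable using (_×-dec_; _⊎-dec_)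

-- Finite, undirected, simple graphs.  Every notion below is invariant under
-- isomorphism, so the vertices are taken to be 0, …, order - 1.  Adjacency is
-- decidable, as befits a finite set of edges.
record Graph : Set₁ where
  infix 4 _~_ _~?_
  field
    order  : ℕ
    _~_    : Rel (Fin order) 0ℓ
    _~?_   : Decidable _~_
    sym    : Symmetric _~_
    irrefl : ∀ {u} → ¬ (u ~ u)

  V : Set
  V = Fin order

  VSet : Set
  VSet = Subset order

  InducedAdj : VSet → Rel V 0ℓ
  InducedAdj A x y = x ∈ A × y ∈ A × x ~ y

  -- The subgraph induced by A is connected.  The empty set satisfies this;
  -- nonemptiness is always required separately.
  Connected : VSet → Set
  Connected A = ∀ {x y} → x ∈ A → y ∈ A → Star (InducedAdj A) x y

  -- E(A , B) ≠ ∅.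
  EdgeBetween : VSet → VSet → Set
  EdgeBetween A B = ∃₂ λ x y → x ∈ A × y ∈ B × x ~ y

  -- Each edge {u , v} is listed exactly once, with u < v.
  edges : List (V × V)
  edges = filter (λ (u , v) → (u <? v) ×-dec (u ~? v))
                 (cartesianProduct (allFin order) (allFin order))

record IsRegionIntersectionGraph (G G₀ : Graph) : Set where
  private
    module G  = Graph G
    module G₀ = Graph G₀
  field
    R           : G.V → G₀.VSet
    R-nonempty  : ∀ u → Nonempty (R u)
    R-connected : ∀ u → G₀.Connected (R u)
    R-adjacency : ∀ {u v} → u ≢ v → (u G.~ v) ⇔ Nonempty (R u ∩ R v)

record BranchSets (H G : Graph) : Set where
  private
    module H = Graph H
    module G = Graph G
  field
    A           : H.V → G.VSet
    A-nonempty  : ∀ u → Nonempty (A u)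
    A-connected : ∀ u → G.Connected (A u)
    A-disjoint  : ∀ {u v} → u ≢ v → Empty (A u ∩ A v)

infix 4 _IsMinorOf_ _IsStrictMinorOf_

_IsMinorOf_ : Graph → Graph → Set
H IsMinorOf G = Σ (BranchSets H G) λ B → let open BranchSets B in
  ∀ {u v} → u H.~ v → G.EdgeBetween (A u) (A v)
  where
    module H = Graph H
    module G = Graph G

_IsStrictMinorOf_ : Graph → Graph → Set
H IsStrictMinorOf G = Σ (BranchSets H G) λ B → let open BranchSets B in
  ∀ {u v} → u ≢ v → (u H.~ v) ⇔ G.EdgeBetween (A u) (A v)
  where
    module H = Graph H
    module G = Graph G

-- The graph obtained from H by subdividing every edge into a path of length
-- two.  Its vertices are those of H (left summand of splitAt) followed by one
-- new vertex for each edge of H (right summand), adjacent precisely to the two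
-- endpoints of that edge.
module Subdivision (H : Graph) where
  open Graph H using (V; order; edges)

  Edge : Set
  Edge = Fin (length edges)

  Incident : V → Edge → Set
  Incident u e = let (a , b) = lookup edges e in u ≡ a ⊎ u ≡ b

  incident? : ∀ u e → Dec (Incident u e)
  incident? u e = let (a , b) = lookup edges e in (u ≟ a) ⊎-dec (u ≟ b)

  SumAdj : Rel (V ⊎ Edge) 0ℓ
  SumAdj (inj₁ u) (inj₁ v) = ⊥
  SumAdj (inj₁ u) (inj₂ e) = Incident u e
  SumAdj (inj₂ e) (inj₁ u) = Incident u e
  SumAdj (inj₂ e) (inj₂ f) = ⊥

  sumAdj? : Decidable SumAdj
  sumAdj? (inj₁ u) (inj₁ v) = no λ ()
  sumAdj? (inj₁ u) (inj₂ e) = incident? u e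
  sumAdj? (inj₂ e) (inj₁ u) = incident? u e
  sumAdj? (inj₂ e) (inj₂ f) = no λ ()

  sumAdj-sym : Symmetric SumAdj
  sumAdj-sym {inj₁ u} {inj₂ e} i = i
  sumAdj-sym {inj₂ e} {inj₁ u} i = i

  sumAdj-irrefl : ∀ x → ¬ SumAdj x x
  sumAdj-irrefl (inj₁ u) ()
  sumAdj-irrefl (inj₂ e) ()

  subdivision : Graph
  subdivision = record
    { order  = order + length edges
    ; _~_    = SumAdj on splitAt order
    ; _~?_   = λ x y → sumAdj? (splitAt order x) (splitAt order y)
    ; sym    = λ {x} {y} → sumAdj-sym {splitAt order x} {splitAt order y}
    ; irrefl = λ {x} → sumAdj-irrefl (splitAt order x)
    }

open Subdivision public using (subdivision)

{-# OPTIONS --safe #-}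

-- A strict minor of a region intersection graph over G₀ is again one: take as
-- the region of x the union of the regions of the vertices in the branch set
-- of x.  So the subdivision of H has regions R over G₀.  For an edge e = {a , b}
-- with a < b the connected set R e meets R a, R b and no other region; walk
-- inside R e from R a until just before R b is first reached.  Adjoining these
-- walks to the sets R a gives the branch sets of H in G₀.
module Submission where

open import Defs
open import Data.Fin using (Fin; splitAt; _<_; _↑ˡ_; _↑ʳ_)
open import Data.Fin.Properties
  using (_≟_; _<?_; any?; <-cmp; <⇒≢; ↑ˡ-injective; ↑ʳ-injective; splitAt-↑ˡ; splitAt-↑ʳ)
open import Data.Fin.Subset
  using (Subset; _∈_; _∉_; _⊆_; _∩_; _∪_; ⁅_⁆; Nonempty; Empty)
open import Data.Fin.Subset.Properties
  using (_∈?_; x∈p∩q⁺; x∈p∩q⁻; x∈p∪q⁻; p⊆p∪q; q⊆p∪q; x∈⁅x⁆; x∈⁅y⁆⇒x≡y)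
open import Data.List using (length; lookup; cartesianProduct; allFin)
open import Data.List.Membership.Propositional.Properties
  using (∈-filter⁺; ∈-filter⁻; ∈-cartesianProduct⁺; ∈-allFin; ∈-lookup)
open import Data.List.Relation.Unary.Any using (index)
open import Data.List.Relation.Unary.Any.Properties using (lookup-index)
open import Data.Nat using (ℕ)
open import Data.Product using (∃; _×_; _,_; proj₁; proj₂)
open import Data.Sum using (_⊎_; inj₁; inj₂; [_,_]′)
open import Data.Vec using (tabulate)
open import Data.Vec.Properties using ([]=⇒lookup; lookup⇒[]=; lookup∘tabulate)
open import Function.Base using (_∘_)
open import Function.Bundles using (mk⇔; module Equivalence)
open import Level using (Level)
open import Relation.Binary.Construct.Closure.ReflexiveTransitive
  using (Star; ε; _◅_; _◅◅_) renaming (map to Star-map; reverse to Star-reverse)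
open import Relation.Binary.Definitions using (Tri; tri<; tri≈; tri>)
open import Relation.Binary.PropositionalEquality
  using (_≡_; _≢_; refl; sym; trans; cong; subst; subst₂)
open import Relation.Nullary using (¬_; Dec; yes; no; does; contradiction)
open import Relation.Nullary.Decidable using (_×-dec_; _⊎-dec_; dec-true)
open import Relation.Unary using (Pred; Decidable)

private
  variable
    ℓ : Level
    n : ℕ

-- Subsets cut out by decidable predicates.

comprehension : {P : Pred (Fin n) ℓ} → Decidable P → Subset n
comprehension P? = tabulate (does ∘ P?)

module _ {P : Pred (Fin n) ℓ} (P? : Decidable P) {x : Fin n} where

  ∈-comprehension⁺ : P x → x ∈ comprehension P?
  ∈-comprehension⁺ px = lookup⇒[]= x _
    (trans (lookup∘tabulate (does ∘ P?) x) (dec-true (P? x) px))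

  ∈-comprehension⁻ : x ∈ comprehension P? → P x
  ∈-comprehension⁻ x∈
    -- Abstracting `P? x` in the equation as well turns the `no` case into `false ≡ true`, which is
    -- absurd.
    with P? x | trans (sym (lookup∘tabulate (does ∘ P?) x)) ([]=⇒lookup x∈)
  ... | yes px | _ = px

⁅⁆-elim : (P : Pred (Fin n) ℓ) {x : Fin n} → P x → ∀ {y} → y ∈ ⁅ x ⁆ → P y
⁅⁆-elim P px y∈ = subst P (sym (x∈⁅y⁆⇒x≡y _ y∈)) px

-- Connected sets and walks in a graph.

module Connectivity (G : Graph) where
  open Graph G hiding (sym)

  InducedAdj-mono : ∀ {A B} → A ⊆ B → ∀ {x y} →
                    Star (InducedAdj A) x y → Star (InducedAdj B) x y
  InducedAdj-mono A⊆B = Star-map λ (x∈A , y∈A , x~y) → A⊆B x∈A , A⊆B y∈A , x~y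

  Star-sym : ∀ {A x y} → Star (InducedAdj A) x y → Star (InducedAdj A) y x
  Star-sym = Star-reverse λ (x∈A , y∈A , x~y) → y∈A , x∈A , Graph.sym G x~y

  EdgeBetween-mono : ∀ {A A′ B B′} → A ⊆ A′ → B ⊆ B′ →
                     EdgeBetween A B → EdgeBetween A′ B′
  EdgeBetween-mono A⊆A′ B⊆B′ (a , b , a∈A , b∈B , a~b) = a , b , A⊆A′ a∈A , B⊆B′ b∈B , a~b

  EdgeBetween-sym : ∀ {A B} → EdgeBetween A B → EdgeBetween B A
  EdgeBetween-sym (a , b , a∈A , b∈B , a~b) = b , a , b∈B , a∈A , Graph.sym G a~b

  rooted⇒connected : ∀ {A} r → (∀ {x} → x ∈ A → Star (InducedAdj A) x r) →
                     Connected A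
  rooted⇒connected r toRoot x∈A y∈A = toRoot x∈A ◅◅ Star-sym (toRoot y∈A)

  connected-⁅⁆ : ∀ {x} → Connected ⁅ x ⁆
  connected-⁅⁆ y∈ z∈ with refl ← x∈⁅y⁆⇒x≡y _ y∈ | refl ← x∈⁅y⁆⇒x≡y _ z∈ = ε

  connected-∪ : ∀ {A B} → Connected A → Connected B → EdgeBetween A B →
                Connected (A ∪ B)
  connected-∪ {A} {B} conA conB (a , b , a∈A , b∈B , a~b) =
    rooted⇒connected b λ x∈ →
      [ (λ x∈A → InducedAdj-mono A⊆ (conA x∈A a∈A) ◅◅ (A⊆ a∈A , B⊆ b∈B , a~b) ◅ ε)
      , (λ x∈B → InducedAdj-mono B⊆ (conB x∈B b∈B))
      ]′ (x∈p∪q⁻ A B x∈)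
    where
    A⊆ : A ⊆ A ∪ B
    A⊆ = p⊆p∪q B
    B⊆ : B ⊆ A ∪ B
    B⊆ = q⊆p∪q A B

  -- The part of a walk in S from x to T that precedes the first visit to T.
  record Approach (S T : VSet) (x : V) : Set where
    field
      P         : VSet
      start     : x ∈ P
      inside    : P ⊆ S
      avoids    : ∀ {z} → z ∈ P → z ∉ T
      connected : Connected P
      arrives   : EdgeBetween P T

  -- Recursion on the walk, with the hypothesis `x ∉ T` renewed at every step that does not yet
  -- reach `T`. Only the vertices passed so far are collected, so `P` misses `T` even where `S`
  -- meets it.
  approach : ∀ {S T x y} → x ∉ T → y ∈ T → Star (InducedAdj S) x y → Approach S T x
  approach x∉T y∈T ε = contradiction y∈T x∉T
  approach {S} {T} {x} x∉T y∈T (_◅_ {j = z} (x∈S , z∈S , x~z) walk) with z ∈? T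
  ... | yes z∈T = record
    { P         = ⁅ x ⁆
    ; start     = x∈⁅x⁆ x
    ; inside    = ⁅⁆-elim (_∈ S) x∈S
    ; avoids    = ⁅⁆-elim (_∉ T) x∉T
    ; connected = connected-⁅⁆
    ; arrives   = x , z , x∈⁅x⁆ x , z∈T , x~z
    }
  ... | no z∉T = record
    { P         = ⁅ x ⁆ ∪ P
    ; start     = p⊆p∪q P (x∈⁅x⁆ x)
    ; inside    = λ w∈ → [ ⁅⁆-elim (_∈ S) x∈S , inside ]′ (x∈p∪q⁻ ⁅ x ⁆ P w∈)
    ; avoids    = λ w∈ → [ ⁅⁆-elim (_∉ T) x∉T , avoids ]′ (x∈p∪q⁻ ⁅ x ⁆ P w∈)
    ; connected = connected-∪ connected-⁅⁆ connected (x , z , x∈⁅x⁆ x , start , x~z)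
    ; arrives   = EdgeBetween-mono (q⊆p∪q ⁅ x ⁆ P) (λ t∈T → t∈T) arrives
    }
    where open Approach (approach z∉T y∈T walk)

-- Regions inherited by a strict minor.

module _ {K G G₀ : Graph} (rig : IsRegionIntersectionGraph G G₀)
         (minor : K IsStrictMinorOf G) where
  private
    module K = Graph K
    module G = Graph G
    module G₀ = Graph G₀
    open IsRegionIntersectionGraph rig
    open BranchSets (proj₁ minor)
    open Connectivity G₀

    InUnion : K.V → Pred G₀.V _
    InUnion x z = ∃ λ g → g ∈ A x × z ∈ R g

    inUnion? : ∀ x → Decidable (InUnion x)
    inUnion? x z = any? λ g → (g ∈? A x) ×-dec (z ∈? R g)

    U : K.V → G₀.VSet
    U x = comprehension (inUnion? x)

    ∈U⁺ : ∀ {x g z} → g ∈ A x → z ∈ R g → z ∈ U x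
    ∈U⁺ {x} g∈A z∈R = ∈-comprehension⁺ (inUnion? x) (_ , g∈A , z∈R)

    ∈U⁻ : ∀ {x z} → z ∈ U x → InUnion x z
    ∈U⁻ {x} = ∈-comprehension⁻ (inUnion? x)

    G-adj⇒≢ : ∀ {g h} → g G.~ h → g ≢ h
    G-adj⇒≢ g~h refl = G.irrefl g~h

    -- Regions of consecutive vertices of a walk in `G` share a vertex `t` of `G₀`, where the walk
    -- inside one region hands over to the walk inside the next.
    U-walk : ∀ {x g h z w} → g ∈ A x → Star (G.InducedAdj (A x)) g h →
             z ∈ R g → w ∈ R h → Star (G₀.InducedAdj (U x)) z w
    U-walk g∈A ε z∈R w∈R = InducedAdj-mono (∈U⁺ g∈A) (R-connected _ z∈R w∈R)
    U-walk g∈A (_◅_ {j = g′} (_ , g′∈A , g~g′) walk) z∈R w∈R =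
      let t , t∈     = Equivalence.to (R-adjacency (G-adj⇒≢ g~g′)) g~g′
          t∈g , t∈g′ = x∈p∩q⁻ _ _ t∈
      in InducedAdj-mono (∈U⁺ g∈A) (R-connected _ z∈R t∈g)
           ◅◅ U-walk g′∈A walk t∈g′ w∈R

    U-connected : ∀ x → G₀.Connected (U x)
    U-connected x z∈U w∈U =
      let _ , g∈A , z∈R = ∈U⁻ z∈U
          _ , h∈A , w∈R = ∈U⁻ w∈U
      in U-walk g∈A (A-connected x g∈A h∈A) z∈R w∈R

    U-nonempty : ∀ x → Nonempty (U x)
    U-nonempty x =
      let g , g∈A = A-nonempty x
          z , z∈R = R-nonempty g
      in z , ∈U⁺ g∈A z∈R

    edge⇒meet : ∀ {x y} → G.EdgeBetween (A x) (A y) → Nonempty (U x ∩ U y)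
    edge⇒meet (g , h , g∈A , h∈A , g~h) =
      let t , t∈    = Equivalence.to (R-adjacency (G-adj⇒≢ g~h)) g~h
          t∈g , t∈h = x∈p∩q⁻ _ _ t∈
      in t , x∈p∩q⁺ (∈U⁺ g∈A t∈g , ∈U⁺ h∈A t∈h)

    meet⇒edge : ∀ {x y} → x ≢ y → Nonempty (U x ∩ U y) → G.EdgeBetween (A x) (A y)
    meet⇒edge {x} {y} x≢y (z , z∈) =
      let z∈x , z∈y = x∈p∩q⁻ (U x) (U y) z∈
          g , g∈A , z∈g = ∈U⁻ z∈x
          h , h∈A , z∈h = ∈U⁻ z∈y
          -- Disjointness of the branch sets supplies the `g ≢ h` that `R-adjacency` asks for.
          g≢h = λ g≡h → A-disjoint x≢y (h , x∈p∩q⁺ (subst (_∈ A x) g≡h g∈A , h∈A))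
      in g , h , g∈A , h∈A , Equivalence.from (R-adjacency g≢h) (z , x∈p∩q⁺ (z∈g , z∈h))

  strictMinor-isRegionIntersectionGraph : IsRegionIntersectionGraph K G₀
  strictMinor-isRegionIntersectionGraph = record
    { R           = U
    ; R-nonempty  = U-nonempty
    ; R-connected = U-connected
    ; R-adjacency = λ x≢y → mk⇔
        (edge⇒meet ∘ Equivalence.to (proj₂ minor x≢y))
        -- Strictness of the minor enters here: an edge of `G` between two branch sets must come
        -- from an edge of `K`.
        (Equivalence.from (proj₂ minor x≢y) ∘ meet⇒edge x≢y)
    }

-- Edges oriented from the smaller endpoint.

module Edges (H : Graph) where
  open Graph H hiding (sym)
  open Subdivision H using (Edge)

  -- This orientation decides which endpoint takes over the walk of the edge.
  source target : Edge → V
  source e = proj₁ (lookup edges e)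
  target e = proj₂ (lookup edges e)

  private
    ordered? : (p : V × V) → Dec (proj₁ p < proj₂ p × proj₁ p ~ proj₂ p)
    ordered? (u , v) = (u <? v) ×-dec (u ~? v)

  source<target : ∀ e → source e < target e
  source<target e =
    proj₁ (proj₂ (∈-filter⁻ ordered? {xs = cartesianProduct (allFin order) (allFin order)}
                             (∈-lookup {xs = edges} e)))

  edge-of : ∀ {u v} → u < v → u ~ v → ∃ λ e → source e ≡ u × target e ≡ v
  edge-of {u} {v} u<v u~v =
    index uv∈ , cong proj₁ (sym (lookup-index uv∈)) , cong proj₂ (sym (lookup-index uv∈))
    where
    uv∈ = ∈-filter⁺ ordered? (∈-cartesianProduct⁺ (∈-allFin u) (∈-allFin v)) (u<v , u~v)

-- Branch sets for `H` from regions of its subdivision.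

module _ {H G₀ : Graph} (rig : IsRegionIntersectionGraph (subdivision H) G₀) where
  private
    module H = Graph H
    module G₀ = Graph G₀
    module Ḣ = Graph (subdivision H)
    open Subdivision H using (Edge; Incident; SumAdj)
    open Edges H
    open IsRegionIntersectionGraph rig
    open Connectivity G₀

    old : H.V → Ḣ.V
    old u = u ↑ˡ length H.edges

    new : Edge → Ḣ.V
    new e = H.order ↑ʳ e

    -- Adjacency in the subdivision goes through `splitAt`, which does not reduce on `old u` or
    -- `new e`; this lemma and the next three transport `SumAdj` along its values there.
    old~new⁺ : ∀ {u e} → Incident u e → old u Ḣ.~ new e
    old~new⁺ {u} {e} = subst₂ SumAdj (sym (splitAt-↑ˡ H.order u _)) (sym (splitAt-↑ʳ H.order _ e))

    old~new⁻ : ∀ {u e} → old u Ḣ.~ new e → Incident u e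
    old~new⁻ {u} {e} = subst₂ SumAdj (splitAt-↑ˡ H.order u _) (splitAt-↑ʳ H.order _ e)

    old≁old : ∀ {u v} → ¬ (old u Ḣ.~ old v)
    old≁old {u} {v} = subst₂ SumAdj (splitAt-↑ˡ H.order u _) (splitAt-↑ˡ H.order v _)

    new≁new : ∀ {e f} → ¬ (new e Ḣ.~ new f)
    new≁new {e} {f} = subst₂ SumAdj (splitAt-↑ʳ H.order _ e) (splitAt-↑ʳ H.order _ f)

    old≢new : ∀ {u e} → old u ≢ new e
    old≢new {u} {e} eq
      with () ← trans (sym (splitAt-↑ˡ H.order u _))
                      (trans (cong (splitAt H.order) eq) (splitAt-↑ʳ H.order _ e))

    meet⇒adj : ∀ {x y z} → x ≢ y → z ∈ R x → z ∈ R y → x Ḣ.~ y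
    meet⇒adj x≢y z∈x z∈y = Equivalence.from (R-adjacency x≢y) (_ , x∈p∩q⁺ (z∈x , z∈y))

    old-disjoint : ∀ {u v z} → u ≢ v → z ∈ R (old u) → z ∉ R (old v)
    old-disjoint u≢v z∈u z∈v =
      old≁old (meet⇒adj (u≢v ∘ ↑ˡ-injective _ _ _) z∈u z∈v)

    new-disjoint : ∀ {e f z} → e ≢ f → z ∈ R (new e) → z ∉ R (new f)
    new-disjoint e≢f z∈e z∈f =
      new≁new (meet⇒adj (e≢f ∘ ↑ʳ-injective _ _ _) z∈e z∈f)

    meet⇒incident : ∀ {u e z} → z ∈ R (old u) → z ∈ R (new e) → Incident u e
    meet⇒incident z∈u z∈e = old~new⁻ (meet⇒adj old≢new z∈u z∈e)

    incident⇒meet : ∀ {u e} → Incident u e → ∃ λ z → z ∈ R (old u) × z ∈ R (new e)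
    incident⇒meet i =
      let z , z∈ = Equivalence.to (R-adjacency old≢new) (old~new⁺ i)
      in z , x∈p∩q⁻ _ _ z∈

    -- The endpoints of `e` differ, so their regions are disjoint and the walk starts outside its
    -- target. Membership of `x` in the source's region is recorded so that the walk can later be
    -- attached to it.
    edgeApproach : ∀ e → ∃ λ x → x ∈ R (old (source e)) ×
                                 Approach (R (new e)) (R (old (target e))) x
    edgeApproach e =
      let x , x∈a , x∈e = incident⇒meet {e = e} (inj₁ refl)
          y , y∈b , y∈e = incident⇒meet {e = e} (inj₂ refl)
      in x , x∈a , approach (old-disjoint (<⇒≢ (source<target e)) x∈a) y∈b
                            (R-connected (new e) x∈e y∈e)

    module EdgeApproach e = Approach (proj₂ (proj₂ (edgeApproach e)))
    open EdgeApproach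

    -- The walk of an edge goes wholly to the source. The target needs no share of it, as the edge
    -- leaving the walk ends in the target's own region.
    InBranch : H.V → Pred G₀.V _
    InBranch u z = z ∈ R (old u) ⊎ ∃ λ e → source e ≡ u × z ∈ P e

    inBranch? : ∀ u → Decidable (InBranch u)
    inBranch? u z = (z ∈? R (old u)) ⊎-dec any? λ e → (source e ≟ u) ×-dec (z ∈? P e)

    B : H.V → G₀.VSet
    B u = comprehension (inBranch? u)

    R⊆B : ∀ {u} → R (old u) ⊆ B u
    R⊆B {u} z∈R = ∈-comprehension⁺ (inBranch? u) (inj₁ z∈R)

    P⊆B : ∀ e → P e ⊆ B (source e)
    P⊆B e z∈P = ∈-comprehension⁺ (inBranch? _) (inj₂ (e , refl , z∈P))

    B-connected : ∀ u → G₀.Connected (B u)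
    B-connected u = rooted⇒connected r λ z∈B → toRoot (∈-comprehension⁻ (inBranch? u) z∈B)
      where
      r = proj₁ (R-nonempty (old u))
      fromR : ∀ {z} → z ∈ R (old u) → Star (G₀.InducedAdj (B u)) z r
      fromR z∈R = InducedAdj-mono R⊆B (R-connected (old u) z∈R (proj₂ (R-nonempty (old u))))
      toRoot : ∀ {z} → InBranch u z → Star (G₀.InducedAdj (B u)) z r
      toRoot (inj₁ z∈R) = fromR z∈R
      -- The walk of `e` begins in the source's region and is joined to the root through that
      -- vertex.
      toRoot (inj₂ (e , refl , z∈P)) =
        InducedAdj-mono (P⊆B e) (connected e z∈P (start e))
          ◅◅ fromR (proj₁ (proj₂ (edgeApproach e)))

    -- Among the old regions, `R (new e)` meets only those of the endpoints of `e`. The source is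
    -- excluded by hypothesis, the target because the walk stops short of it.
    P-avoids : ∀ {e v z} → source e ≢ v → z ∈ P e → z ∉ R (old v)
    P-avoids {e} a≢v z∈P z∈v with meet⇒incident z∈v (inside e z∈P)
    ... | inj₁ v≡a  = a≢v (sym v≡a)
    ... | inj₂ refl = avoids e z∈P z∈v

    InBranch-disjoint : ∀ {u v z} → u ≢ v → InBranch u z → ¬ InBranch v z
    InBranch-disjoint u≢v (inj₁ z∈u) (inj₁ z∈v) = old-disjoint u≢v z∈u z∈v
    InBranch-disjoint u≢v (inj₁ z∈u) (inj₂ (f , refl , z∈f)) = P-avoids (u≢v ∘ sym) z∈f z∈u
    InBranch-disjoint u≢v (inj₂ (e , refl , z∈e)) (inj₁ z∈v) = P-avoids u≢v z∈e z∈v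
    InBranch-disjoint u≢v (inj₂ (e , refl , z∈e)) (inj₂ (f , refl , z∈f)) =
      -- Distinct sources force distinct edges, whose new vertices are non-adjacent and so have
      -- disjoint regions.
      new-disjoint (u≢v ∘ cong source) (inside e z∈e) (inside f z∈f)

    B-disjoint : ∀ {u v} → u ≢ v → Empty (B u ∩ B v)
    B-disjoint {u} {v} u≢v (z , z∈) =
      let z∈u , z∈v = x∈p∩q⁻ (B u) (B v) z∈
      in InBranch-disjoint u≢v (∈-comprehension⁻ (inBranch? u) z∈u)
                               (∈-comprehension⁻ (inBranch? v) z∈v)

    P-edge : ∀ e → G₀.EdgeBetween (B (source e)) (B (target e))
    -- The step by which the walk enters the target's region realises `e` in `G₀`.
    P-edge e = EdgeBetween-mono (P⊆B e) R⊆B (arrives e)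

    B-edge-< : ∀ {u v} → u < v → u H.~ v → G₀.EdgeBetween (B u) (B v)
    B-edge-< u<v u~v =
      let e , a≡u , b≡v = edge-of u<v u~v
      in subst₂ (λ u v → G₀.EdgeBetween (B u) (B v)) a≡u b≡v (P-edge e)

    B-edge : ∀ {u v} → u H.~ v → G₀.EdgeBetween (B u) (B v)
    B-edge {u} {v} u~v = byOrder (<-cmp u v)
      where
      byOrder : Tri (u < v) (u ≡ v) (v < u) → G₀.EdgeBetween (B u) (B v)
      byOrder (tri< u<v _ _)  = B-edge-< u<v u~v
      byOrder (tri≈ _ refl _) = contradiction u~v H.irrefl
      byOrder (tri> _ _ v<u)  = EdgeBetween-sym (B-edge-< v<u (H.sym u~v))

  subdivision-rig⇒minor : H IsMinorOf G₀
  subdivision-rig⇒minor =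
    record
      { A           = B
      ; A-nonempty  = λ u → let z , z∈R = R-nonempty (old u) in z , R⊆B z∈R
      ; A-connected = B-connected
      ; A-disjoint  = B-disjoint
      } , B-edge

lemma1p5 : (G₀ G H : Graph) → IsRegionIntersectionGraph G G₀ → subdivision H IsStrictMinorOf G → H IsMinorOf G₀
lemma1p5 G₀ G H rig minor =
  subdivision-rig⇒minor (strictMinor-isRegionIntersectionGraph rig minor)
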